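{- Let $\bar{a}(N)$ denote the number of partitions $\lambda$ of $N$ with at least two parts, no parts of size $1$, and $\lambda_1=\lambda_2$. For every integer $j\ge 4$, $$PM(3j,j)-PM(3j-2,j-1)=\bar{a}(2j+1)+1.$$
   Context: A partition $\lambda=(\lambda_1\ge\cdots\ge\lambda_\ell)$ of $n$ is a finite nonincreasing sequence of positive integers with sum $n$; $\ell(\lambda)$ is its number of parts. The hook length $h_{(i,j)}(\lambda)$ of a cell $(i,j)$ of the Ferrers diagram is the number of cells consisting of the cell itself, the cells to its right in its row and the cells below it in its column. A numerical set is a subset $S\subseteq\mathbb{N}_0$ containing $0$ with finite complement; a numerical semigroup is a numerical set closed under addition. For a partition $\lambda$ let $S_\lambda=\mathbb{N}_0\setminus\{h_{(i,1)}(\lambda):1\le i\le\ell(\lambda)\}$. $PM(n,m)$ is the number of partitions $\lambda$ of $n$ having exactly $m-1$ parts equal to $1$ such that $S_\lambda$ is a numerical semigroup. -}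

module Defs where

open import Data.Nat using (ℕ; zero; suc; _+_; _∸_; _≤_; _<_; _≤?_)
open import Data.List using (List; []; _∷_; length; filter)
open import Data.Nat.ListAction using (sum)
open import Data.List.Relation.Unary.All using (All)
open import Data.List.Relation.Unary.Linked using (Linked)
open import Data.List.Relation.Unary.Unique.Propositional using (Unique)
open import Data.List.Membership.Propositional using (_∈_)
open import Data.Nat using (_≟_)
open import Data.Product using (Σ; ∃; _×_)
open import Relation.Binary.PropositionalEquality using (_≡_)
open import Relation.Nullary using (¬_)
open import Function.Bundles using (_⇔_)

record IsPartitionOf (n : ℕ) (ps : List ℕ) : Set where
  field
    positive    : All (λ p → 0 < p) ps
    nonincr     : Linked (λ a b → b ≤ a) ps
    sumEq       : sum ps ≡ n

len : List ℕ → ℕ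
len = length

-- λ_i, 1-based; 0 outside the range 1..ℓ
part : List ℕ → ℕ → ℕ
part []       _             = 0
part (p ∷ ps) zero          = 0
part (p ∷ ps) (suc zero)    = p
part (p ∷ ps) (suc (suc i)) = part ps (suc i)

conj : List ℕ → ℕ → ℕ
conj ps j = length (filter (λ p → j ≤? p) ps)

-- hook length of cell (i , j) (1-based) of the Ferrers diagram:
-- the cell itself, the λ_i - j cells to its right, the λ'_j - i cells below it.
hook : List ℕ → ℕ → ℕ → ℕ
hook ps i j = 1 + (part ps i ∸ j) + (conj ps j ∸ i)

InS : List ℕ → ℕ → Set
InS ps x = ¬ (Σ ℕ λ i → (1 ≤ i) × (i ≤ len ps) × (hook ps i 1 ≡ x))

-- S_λ is a numerical semigroup: contains 0 and is closed under addition
-- (finite complement holds automatically, the complement being a finite set of hooks).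
IsNumericalSemigroupS : List ℕ → Set
IsNumericalSemigroupS ps = InS ps 0 × (∀ x y → InS ps x → InS ps y → InS ps (x + y))

ones : List ℕ → ℕ
ones ps = length (filter (λ p → p ≟ 1) ps)

IsCount : (List ℕ → Set) → ℕ → Set
IsCount P k = Σ (List (List ℕ)) λ L → Unique L × (∀ ps → (ps ∈ L) ⇔ P ps) × (length L ≡ k)

PMis : ℕ → ℕ → ℕ → Set
PMis n m k = IsCount (λ ps → IsPartitionOf n ps × (ones ps + 1 ≡ m) × IsNumericalSemigroupS ps) k

aBarIs : ℕ → ℕ → Set
aBarIs N k = IsCount (λ ps → IsPartitionOf N ps × (2 ≤ len ps) × (ones ps ≡ 0) × (part ps 1 ≡ part ps 2)) k

{-# OPTIONS --safe #-}
module Submission where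

-- Strip the m - 1 parts equal to 1. Then PM(3j, j) counts partitions μ of 2j + 1 without ones and
-- PM(3j - 2, j - 1) counts such partitions of 2j, with S required to be closed. The gaps above the
-- multiplicity m are m - 1 + g, where g runs over the first-column hooks of μ. Because μ is so
-- small, all gaps but the largest are below 2m, except in a few extremal cases, so that closedness
-- only constrains the decompositions of the largest gap 2m + t and depends on t alone. Hence
-- increasing the largest part by 1, while passing from m = j - 1 to m = j, preserves closedness.
-- This matches all partitions counted by PM(3j - 2, j - 1) with those counted by PM(3j, j) having
-- λ₁ > λ₂, except for the family (y+1, y, 2, …, 2) with 2 ≤ y < j. The partitions counted by
-- PM(3j, j) with λ₁ = λ₂ are all partitions counted by ā(2j + 1) except (y, y, 3, 2, …, 2), for
-- which 2j is a gap. Moving a cell turns (y, y, 3, 2, …) into (y+1, y, 2, 2, …), which accounts for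
-- the exceptional family apart from y = 2; that one is the summand 1.

open import Defs
open import Data.Nat using (ℕ; zero; suc; _+_; _*_; _∸_; _≤_; _<_; _≥_; z≤n; s≤s; s≤s⁻¹; _≟_; _≤?_)
open import Data.Nat.Properties
open import Data.Nat.ListAction using (sum)
open import Data.Nat.ListAction.Properties using (sum-++)
open import Data.Nat.Tactic.RingSolver using (solve-∀)
open import Data.List using (List; []; _∷_; [_]; _++_; length; map; filter; replicate)
open import Data.List.Properties using (length-++; length-map; length-replicate; filter-all; filter-none; filter-reject; filter-++; ++-cancelʳ; ++-identityʳ)
open import Data.List.Membership.Propositional using (_∈_; _∉_)
open import Data.List.Membership.DecPropositional _≟_ using (_∈?_)
open import Data.List.Membership.Propositional.Properties using (∈-∃++; ∈-++⁺ˡ; ∈-++⁺ʳ; ∈-++⁻; ∈-map⁺; ∈-map⁻)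
open import Data.List.Relation.Unary.Any using (here; there)
open import Data.List.Relation.Unary.All as All using (All; []; _∷_)
import Data.List.Relation.Unary.All.Properties as Allₚ
open import Data.List.Relation.Unary.AllPairs using ([]; _∷_)
open import Data.List.Relation.Unary.Linked as Linked using (Linked; []; [-]; _∷_)
open import Data.List.Relation.Unary.Linked.Properties using (Linked⇒All)
open import Data.List.Relation.Unary.Unique.Propositional using (Unique)
import Data.List.Relation.Unary.Unique.Propositional.Properties as Uniqueₚ
open import Data.Product using (Σ; ∃; ∃₂; _×_; _,_; proj₁)
open import Data.Sum as Sum using (_⊎_; inj₁; inj₂)
open import Data.Sum.Properties using (inj₁-injective; inj₂-injective)
open import Data.Unit using (⊤; tt)
open import Function using (_∘_; flip)
open import Function.Bundles using (_⇔_; mk⇔; Equivalence)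
open import Relation.Binary.PropositionalEquality using (_≡_; _≢_; refl; sym; trans; cong; cong₂; subst; module ≡-Reasoning)
open import Relation.Nullary using (¬_; yes; no; contradiction)

open Equivalence using (to; from)

-- Counting

module _ {A B : Set} {R : A → B → Set} (injective : ∀ {x x′ y} → R x y → R x′ y → x ≡ x′) where

  -- Pigeonhole by induction on `xs`: the partner of the head is deleted from `ys`, and injectivity
  -- together with uniqueness of `xs` keeps it from being the partner of a later element.
  length-≤-of-injective-relation : ∀ {xs} ys → Unique xs → (∀ {x} → x ∈ xs → ∃ λ y → y ∈ ys × R x y) → length xs ≤ length ys
  length-≤-of-injective-relation ys []          total = z≤n
  length-≤-of-injective-relation ys (x∉ ∷ uniq) total
    with y , y∈ , Rxy ← total (here refl)
    with us , vs , refl ← ∈-∃++ y∈ = begin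
      _                            ≤⟨ s≤s (length-≤-of-injective-relation (us ++ vs) uniq total′) ⟩
      suc (length (us ++ vs))      ≡⟨ cong suc (length-++ us) ⟩
      suc (length us + length vs)  ≡⟨ +-suc (length us) (length vs) ⟨
      length us + suc (length vs)  ≡⟨ length-++ us ⟨
      length (us ++ y ∷ vs)        ∎
    where
    open ≤-Reasoning
    total′ : ∀ {x} → x ∈ _ → ∃ λ y → y ∈ us ++ vs × R x y
    total′ x∈ with total (there x∈)
    ... | y′ , y′∈ , Rxy′ with ∈-++⁻ us y′∈
    ... | inj₁ y′∈us         = y′ , ∈-++⁺ˡ y′∈us , Rxy′
    ... | inj₂ (there y′∈vs) = y′ , ∈-++⁺ʳ us y′∈vs , Rxy′
    ... | inj₂ (here refl)   = contradiction (injective Rxy Rxy′) (All.lookup x∉ x∈)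

-- `IsCount` over an arbitrary carrier: the right-hand side of the theorem is counted on a disjoint
-- union of three types.
Count : {A : Set} → (A → Set) → ℕ → Set
Count {A} P k = Σ (List A) λ L → Unique L × (∀ x → (x ∈ L) ⇔ P x) × (length L ≡ k)

-- A relation replaces a bijection, so that the correspondence can be given by constructors; the
-- pigeonhole bound is applied to it and to its converse.
Count-unique-of-relation : {A B : Set} {P : A → Set} {Q : B → Set} {k l : ℕ} (R : A → B → Set) →
  (∀ {x x′ y} → R x y → R x′ y → x ≡ x′) → (∀ {x y y′} → R x y → R x y′ → y ≡ y′) →
  (∀ x → P x → ∃ λ y → Q y × R x y) → (∀ y → Q y → ∃ λ x → P x × R x y) →
  Count P k → Count Q l → k ≡ l
Count-unique-of-relation R injective functional total surjective (L , uL , mL , refl) (M , uM , mM , refl) =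
  ≤-antisym
    (length-≤-of-injective-relation {R = R} injective M uL
      λ x∈ → let y , Qy , r = total _ (to (mL _) x∈) in y , from (mM _) Qy , r)
    (length-≤-of-injective-relation {R = flip R} functional L uM
      λ y∈ → let x , Px , r = surjective _ (to (mM _) y∈) in x , from (mL _) Px , r)

Count-⊎ : {A B : Set} {P : A → Set} {Q : B → Set} {k l : ℕ} → Count P k → Count Q l → Count Sum.[ P , Q ] (k + l)
Count-⊎ {P = P} {Q} (L , uL , mL , refl) (M , uM , mM , refl) =
    map inj₁ L ++ map inj₂ M
  , Uniqueₚ.++⁺ (Uniqueₚ.map⁺ inj₁-injective uL) (Uniqueₚ.map⁺ inj₂-injective uM) disjoint
  , (λ z → mk⇔ (sound z) (complete z))
  , trans (length-++ (map inj₁ L)) (cong₂ _+_ (length-map inj₁ L) (length-map inj₂ M))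
  where
  disjoint : ∀ {z} → ¬ (z ∈ map inj₁ L × z ∈ map inj₂ M)
  disjoint (z∈ , z∈′) with ∈-map⁻ inj₁ z∈ | ∈-map⁻ inj₂ z∈′
  ... | _ , _ , refl | _ , _ , ()
  sound : ∀ z → z ∈ map inj₁ L ++ map inj₂ M → Sum.[ P , Q ] z
  sound z z∈ with ∈-++⁻ (map inj₁ L) z∈
  ... | inj₁ z∈L with _ , x∈ , refl ← ∈-map⁻ inj₁ z∈L = to (mL _) x∈
  ... | inj₂ z∈M with _ , y∈ , refl ← ∈-map⁻ inj₂ z∈M = to (mM _) y∈
  complete : ∀ z → Sum.[ P , Q ] z → z ∈ map inj₁ L ++ map inj₂ M
  complete (inj₁ x) Px = ∈-++⁺ˡ (∈-map⁺ inj₁ (from (mL x) Px))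
  complete (inj₂ y) Qy = ∈-++⁺ʳ (map inj₁ L) (∈-map⁺ inj₂ (from (mM y) Qy))

Count-⊤ : Count {⊤} (λ _ → ⊤) 1
Count-⊤ = [ tt ] , [] ∷ [] , (λ _ → mk⇔ (λ _ → tt) (λ _ → here refl)) , refl

-- First-column hook lengths

-- The first cell of row `p` has `p - 1` cells to its right and `length ps` cells below it. Rows
-- above do not affect a hook, hence the recursion.
hooks : List ℕ → List ℕ
hooks []       = []
hooks (p ∷ ps) = p + length ps ∷ hooks ps

hooks-lower : ∀ {b ps} → All (b ≤_) ps → All (b ≤_) (hooks ps)
hooks-lower []         = []
hooks-lower (b≤ ∷ b≤s) = ≤-trans b≤ (m≤m+n _ _) ∷ hooks-lower b≤s

hooks-upper : ∀ {p ps} → Linked _≥_ (p ∷ ps) → All (_≤ p + length ps) (hooks (p ∷ ps))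
hooks-upper [-]        = ≤-refl ∷ []
hooks-upper (q≤p ∷ ps) = ≤-refl ∷ All.map (λ h≤ → ≤-trans h≤ (+-mono-≤ q≤p (n≤1+n _))) (hooks-upper ps)

private
  hook-head : ∀ p k → 0 < p → 1 + (p ∸ 1) + k ≡ p + k
  hook-head (suc p) k _ = refl

  -- hook ps i 1, once conj ps 1 is known to be the number of parts
  columnHook : List ℕ → ℕ → ℕ
  columnHook ps i = 1 + (part ps i ∸ 1) + (length ps ∸ i)

  columnHook∈hooks : ∀ {ps} → All (0 <_) ps → ∀ i → 1 ≤ i → i ≤ length ps → columnHook ps i ∈ hooks ps
  columnHook∈hooks []                 i             1≤i i≤ = contradiction (≤-trans 1≤i i≤) λ ()
  columnHook∈hooks {p ∷ ps} (0<p ∷ _) (suc zero)    1≤i i≤ = here (hook-head p (length ps) 0<p)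
  columnHook∈hooks (_ ∷ pos)          (suc (suc i)) 1≤i i≤ = there (columnHook∈hooks pos (suc i) (s≤s z≤n) (s≤s⁻¹ i≤))

  hooks⇒columnHook : ∀ {ps x} → All (0 <_) ps → x ∈ hooks ps → ∃ λ i → 1 ≤ i × i ≤ length ps × columnHook ps i ≡ x
  hooks⇒columnHook {p ∷ ps} (0<p ∷ _) (here refl) = 1 , s≤s z≤n , s≤s z≤n , hook-head p (length ps) 0<p
  hooks⇒columnHook (_ ∷ pos) (there x∈) with hooks⇒columnHook pos x∈
  ... | suc i , 1≤i , i≤ , eq = suc (suc i) , s≤s z≤n , s≤s i≤ , eq

InS⇔∉hooks : ∀ {ps} → All (0 <_) ps → ∀ x → InS ps x ⇔ x ∉ hooks ps
InS⇔∉hooks {ps} pos x = mk⇔ ⇒ ⇐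
  where
  hook≡columnHook : ∀ i → hook ps i 1 ≡ columnHook ps i
  hook≡columnHook i = cong (λ l → 1 + (part ps i ∸ 1) + (length l ∸ i)) (filter-all (1 ≤?_) pos)
  ⇒ : InS ps x → x ∉ hooks ps
  ⇒ inS x∈ with i , 1≤i , i≤ , eq ← hooks⇒columnHook pos x∈ = inS (i , 1≤i , i≤ , trans (hook≡columnHook i) eq)
  ⇐ : x ∉ hooks ps → InS ps x
  ⇐ x∉ (i , 1≤i , i≤ , refl) = x∉ (subst (_∈ hooks ps) (sym (hook≡columnHook i)) (columnHook∈hooks pos i 1≤i i≤))

-- The semigroup condition

-- If G lists the first-column hooks of μ, then the nonzero elements outside S for the partition
-- obtained from μ by appending c ones are 1, …, c and c + g for g ∈ G. With m = c + 1, elements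
-- m + a and m + b of S are required not to sum to a gap c + g, that is g = m + 1 + a + b.
Closed : ℕ → List ℕ → Set
Closed m G = ∀ a b → suc m + (a + b) ∈ G → suc a ∈ G ⊎ suc b ∈ G

hooks-ones⁺ : ∀ c {x} → 0 < x → x ≤ c → x ∈ hooks (replicate c 1)
hooks-ones⁺ zero    0<x x≤0 = contradiction (≤-trans 0<x x≤0) λ ()
hooks-ones⁺ (suc c) {x} 0<x x≤ with x ≟ suc c
... | yes refl = here (cong suc (sym (length-replicate c)))
... | no  x≢   = there (hooks-ones⁺ c 0<x (s≤s⁻¹ (≤∧≢⇒< x≤ x≢)))

hooks-ones⁻ : ∀ c {x} → x ∈ hooks (replicate c 1) → x ≤ c
hooks-ones⁻ (suc c) (here refl) = s≤s (≤-reflexive (length-replicate c))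
hooks-ones⁻ (suc c) (there x∈)  = m≤n⇒m≤1+n (hooks-ones⁻ c x∈)

-- Appended ones lengthen the leg of every first-column cell of `μ` by `c`.
hooks-++-ones : ∀ μ c → hooks (μ ++ replicate c 1) ≡ map (c +_) (hooks μ) ++ hooks (replicate c 1)
hooks-++-ones []      c = refl
hooks-++-ones (p ∷ μ) c = cong₂ _∷_ eq (hooks-++-ones μ c)
  where
  open ≡-Reasoning
  swap : ∀ p l c → p + (l + c) ≡ c + (p + l)
  swap = solve-∀
  eq : p + length (μ ++ replicate c 1) ≡ c + (p + length μ)
  eq = begin
    p + length (μ ++ replicate c 1)           ≡⟨ cong (p +_) (length-++ μ) ⟩
    p + (length μ + length (replicate c 1))   ≡⟨ cong (λ l → p + (length μ + l)) (length-replicate c) ⟩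
    p + (length μ + c)                        ≡⟨ swap p (length μ) c ⟩
    c + (p + length μ)                        ∎

module _ {μ : List ℕ} (c : ℕ) where

  private
    ps = μ ++ replicate c 1

  gap⁻ : ∀ {x} → x ∈ hooks ps → (∃ λ g → g ∈ hooks μ × x ≡ c + g) ⊎ x ≤ c
  gap⁻ x∈ with ∈-++⁻ (map (c +_) (hooks μ)) (subst (_ ∈_) (hooks-++-ones μ c) x∈)
  ... | inj₁ x∈μ = inj₁ (∈-map⁻ (c +_) x∈μ)
  ... | inj₂ x∈1 = inj₂ (hooks-ones⁻ c x∈1)

  gap⁺-large : ∀ {g} → g ∈ hooks μ → c + g ∈ hooks ps
  gap⁺-large g∈ = subst (_ ∈_) (sym (hooks-++-ones μ c)) (∈-++⁺ˡ (∈-map⁺ (c +_) g∈))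

  gap⁺-small : ∀ {x} → 0 < x → x ≤ c → x ∈ hooks ps
  gap⁺-small 0<x x≤c = subst (_ ∈_) (sym (hooks-++-ones μ c)) (∈-++⁺ʳ (map (c +_) (hooks μ)) (hooks-ones⁺ c 0<x x≤c))

  private
    above-c : ∀ {a} → ¬ suc c + a ≤ c
    above-c {a} le = 1+n≰n (≤-trans (m≤m+n (suc c) a) le)

    sum-shape : ∀ c a b → (suc c + a) + (suc c + b) ≡ c + (suc (suc c) + (a + b))
    sum-shape = solve-∀

  closed-of-semigroup : (∀ x y → x ∉ hooks ps → y ∉ hooks ps → x + y ∉ hooks ps) → Closed (suc c) (hooks μ)
  closed-of-semigroup semi a b g∈ with suc a ∈? hooks μ | suc b ∈? hooks μ
  ... | yes a∈ | _      = inj₁ a∈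
  ... | no  _  | yes b∈ = inj₂ b∈
  ... | no a∉  | no b∉  =
    contradiction (subst (_∈ hooks ps) (sym (sum-shape c a b)) (gap⁺-large g∈)) (semi _ _ (∉gap a∉) (∉gap b∉))
    where
    ∉gap : ∀ {a} → suc a ∉ hooks μ → suc c + a ∉ hooks ps
    ∉gap {a} a∉ x∈ with gap⁻ x∈
    ... | inj₂ le = above-c le
    ... | inj₁ (g , g∈ , eq) = a∉ (subst (_∈ hooks μ) (+-cancelˡ-≡ c g (suc a) (trans (sym eq) (sym (+-suc c a)))) g∈)

  semigroup-of-closed : Closed (suc c) (hooks μ) → ∀ x y → x ∉ hooks ps → y ∉ hooks ps → x + y ∉ hooks ps
  semigroup-of-closed closed zero        y       x∉ y∉ = y∉
  semigroup-of-closed closed x@(suc _)   zero    x∉ y∉ = subst (_∉ hooks ps) (sym (+-identityʳ x)) x∉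
  semigroup-of-closed closed x@(suc _) y@(suc _) x∉ y∉ x+y∈
    -- Since 1, ..., c are gaps, nonzero elements of S have the form m + a and m + b with m = c + 1.
    with a , refl ← m≤n⇒∃[o]m+o≡n (≰⇒> (x∉ ∘ gap⁺-small {x} (s≤s z≤n)))
    with b , refl ← m≤n⇒∃[o]m+o≡n (≰⇒> (y∉ ∘ gap⁺-small {y} (s≤s z≤n)))
    with gap⁻ x+y∈
  ... | inj₂ le = above-c (≤-trans (m≤m+n _ y) le)
  ... | inj₁ (g , g∈ , eq)
    with refl ← +-cancelˡ-≡ c _ _ (trans (sym (sum-shape c a b)) eq)
    with closed a b g∈
  ... | inj₁ a∈ = x∉ (subst (_∈ hooks ps) (+-suc c a) (gap⁺-large a∈))
  ... | inj₂ b∈ = y∉ (subst (_∈ hooks ps) (+-suc c b) (gap⁺-large b∈))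

-- Partitions without parts equal to 1

record OnelessPartitionOf (s : ℕ) (μ : List ℕ) : Set where
  constructor oneless
  field
    atLeast2 : All (2 ≤_) μ
    nonincr  : Linked _≥_ μ
    sumEq    : sum μ ≡ s

Linked-++⁻ˡ : ∀ μ {νs} → Linked _≥_ (μ ++ νs) → Linked _≥_ μ
Linked-++⁻ˡ []          _        = []
Linked-++⁻ˡ (p ∷ [])    _        = [-]
Linked-++⁻ˡ (p ∷ q ∷ μ) (r ∷ rs) = r ∷ Linked-++⁻ˡ (q ∷ μ) rs

replicate-nonincr : ∀ c x → Linked _≥_ (replicate c x)
replicate-nonincr zero          x = []
replicate-nonincr (suc zero)    x = [-]
replicate-nonincr (suc (suc c)) x = ≤-refl ∷ replicate-nonincr (suc c) x

++-ones-nonincr : ∀ {μ} c → All (2 ≤_) μ → Linked _≥_ μ → Linked _≥_ (μ ++ replicate c 1)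
++-ones-nonincr c       _          []       = replicate-nonincr c 1
++-ones-nonincr zero    _          [-]      = [-]
++-ones-nonincr (suc c) (2≤p ∷ _)  [-]      = ≤-trans (s≤s z≤n) 2≤p ∷ replicate-nonincr (suc c) 1
++-ones-nonincr c       (_ ∷ 2≤s)  (r ∷ rs) = r ∷ ++-ones-nonincr c 2≤s rs

sum-ones : ∀ c → sum (replicate c 1) ≡ c
sum-ones zero    = refl
sum-ones (suc c) = cong suc (sum-ones c)

2≤⇒≢1 : ∀ {p} → 2 ≤ p → p ≢ 1
2≤⇒≢1 (s≤s ()) refl

ones-oneless : ∀ {μ} → All (2 ≤_) μ → ones μ ≡ 0
ones-oneless 2≤s = cong length (filter-none (_≟ 1) (All.map 2≤⇒≢1 2≤s))

ones-++-ones : ∀ {μ} c → All (2 ≤_) μ → ones (μ ++ replicate c 1) ≡ c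
ones-++-ones {μ} c 2≤s = begin
  length (filter (_≟ 1) (μ ++ replicate c 1))  ≡⟨ cong length (filter-++ (_≟ 1) μ (replicate c 1)) ⟩
  length (filter (_≟ 1) μ ++ filter (_≟ 1) (replicate c 1))
    ≡⟨ cong₂ (λ u v → length (u ++ v)) (filter-none (_≟ 1) (All.map 2≤⇒≢1 2≤s)) (filter-all (_≟ 1) (Allₚ.replicate⁺ c refl)) ⟩
  length (replicate c 1)                       ≡⟨ length-replicate c ⟩
  c                                            ∎
  where open ≡-Reasoning

all-ones : ∀ {ps} → All (1 ≡_) ps → ps ≡ replicate (ones ps) 1
all-ones []            = refl
all-ones (refl ∷ ones) = cong (1 ∷_) (all-ones ones)

-- In a nonincreasing list of positive parts, every part after the first 1 is squeezed to 1.
split-ones : ∀ {ps} → All (0 <_) ps → Linked _≥_ ps →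
  ∃ λ μ → All (2 ≤_) μ × Linked _≥_ μ × ps ≡ μ ++ replicate (ones ps) 1
split-ones {[]}     _            _      = [] , [] , [] , refl
split-ones {p ∷ ps} (0<p ∷ pos)  linked with p ≟ 1
... | yes refl = [] , [] , [] , cong (1 ∷_)
  (all-ones (All.zipWith (λ (0<q , q≤1) → ≤-antisym 0<q q≤1) (pos , All.tail (Linked⇒All (λ a b → ≤-trans b a) ≤-refl linked))))
... | no p≢1 with μ , 2≤s , _ , eq ← split-ones pos (Linked.tail linked) =
    p ∷ μ , ≤∧≢⇒< 0<p (p≢1 ∘ sym) ∷ 2≤s
  , Linked-++⁻ˡ (p ∷ μ) (subst (λ l → Linked _≥_ (p ∷ l)) eq linked)
  , cong (p ∷_) (trans eq (cong (λ l → μ ++ replicate (length l) 1) (sym (filter-reject (_≟ 1) p≢1))))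

IsPM : ℕ → ℕ → List ℕ → Set
IsPM n m ps = IsPartitionOf n ps × (ones ps + 1 ≡ m) × IsNumericalSemigroupS ps

-- The sizes are tied by `s + c ≡ n`, so no subtraction occurs; the multiplicity is one more than
-- the number `c` of ones.
IsPM⁻ : ∀ {n c ps} s → s + c ≡ n → IsPM n (suc c) ps →
  ∃ λ μ → ps ≡ μ ++ replicate c 1 × OnelessPartitionOf s μ × Closed (suc c) (hooks μ)
IsPM⁻ {c = c} {ps} s refl (partition , ones≡ , _ , semi)
  with refl ← +-cancelʳ-≡ 1 (ones ps) c (trans ones≡ (+-comm 1 c))
  with μ , 2≤s , linked , eq ← split-ones (IsPartitionOf.positive partition) (IsPartitionOf.nonincr partition) =
    μ , eq
  , oneless 2≤s linked (+-cancelʳ-≡ (ones ps) (sum μ) s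
      (begin
        sum μ + ones ps                          ≡⟨ cong (sum μ +_) (sum-ones (ones ps)) ⟨
        sum μ + sum (replicate (ones ps) 1)      ≡⟨ sum-++ μ _ ⟨
        sum (μ ++ replicate (ones ps) 1)         ≡⟨ cong sum eq ⟨
        sum ps                                   ≡⟨ IsPartitionOf.sumEq partition ⟩
        s + ones ps                              ∎))
  , closed-of-semigroup (ones ps) (subst (λ l → ∀ x y → x ∉ hooks l → y ∉ hooks l → x + y ∉ hooks l) eq
      (λ x y x∉ y∉ → to (InS≈ (x + y)) (semi x y (from (InS≈ x) x∉) (from (InS≈ y) y∉))))
  where
  open ≡-Reasoning
  InS≈ = InS⇔∉hooks (IsPartitionOf.positive partition)

IsPM⁺ : ∀ {n c s μ} → s + c ≡ n → OnelessPartitionOf s μ → Closed (suc c) (hooks μ) → IsPM n (suc c) (μ ++ replicate c 1)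
IsPM⁺ {c = c} {μ = μ} refl (oneless 2≤s linked refl) closed =
    record
      { positive = pos
      ; nonincr  = ++-ones-nonincr c 2≤s linked
      ; sumEq    = trans (sum-++ μ (replicate c 1)) (cong (sum μ +_) (sum-ones c))
      }
  , trans (cong (_+ 1) (ones-++-ones c 2≤s)) (+-comm c 1)
  , from (InS≈ 0) (λ 0∈ → contradiction (All.lookup (hooks-lower pos) 0∈) λ ())
  , λ x y x∈ y∈ → from (InS≈ (x + y)) (semigroup-of-closed {μ} c closed x y (to (InS≈ x) x∈) (to (InS≈ y) y∈))
  where
  pos : All (0 <_) (μ ++ replicate c 1)
  pos = Allₚ.++⁺ (All.map (≤-trans (s≤s z≤n)) 2≤s) (Allₚ.replicate⁺ c (s≤s z≤n))
  InS≈ = InS⇔∉hooks pos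

-- Partitions with equal largest parts

IsABar : ℕ → List ℕ → Set
IsABar N ps = IsPartitionOf N ps × (2 ≤ len ps) × (ones ps ≡ 0) × (part ps 1 ≡ part ps 2)

IsABar⁻ : ∀ {N ps} → IsABar N ps → ∃₂ λ y ν → ps ≡ y ∷ y ∷ ν × OnelessPartitionOf N ps
IsABar⁻ {ps = []}        (_ , () , _)
IsABar⁻ {ps = _ ∷ []}    (_ , s≤s () , _)
IsABar⁻ {ps = y ∷ _ ∷ ν} (partition , _ , ones≡0 , refl)
  with μ , 2≤s , linked , eq ← split-ones (IsPartitionOf.positive partition) (IsPartitionOf.nonincr partition)
  with refl ← trans eq (trans (cong (λ c → μ ++ replicate c 1) ones≡0) (++-identityʳ μ)) =
  y , ν , refl , oneless 2≤s linked (IsPartitionOf.sumEq partition)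

IsABar⁺ : ∀ {N y ν} → OnelessPartitionOf N (y ∷ y ∷ ν) → IsABar N (y ∷ y ∷ ν)
IsABar⁺ (oneless 2≤s linked sum≡) =
    record { positive = All.map (≤-trans (s≤s z≤n)) 2≤s ; nonincr = linked ; sumEq = sum≡ }
  , s≤s (s≤s z≤n) , ones-oneless 2≤s , refl

-- Extremal partitions

sum-lower : ∀ {ν} → All (2 ≤_) ν → length ν + length ν ≤ sum ν
sum-lower []                 = z≤n
sum-lower {p ∷ ν} (2≤p ∷ 2≤s) = begin
  suc (length ν + suc (length ν))  ≡⟨ cong suc (+-suc (length ν) (length ν)) ⟩
  2 + (length ν + length ν)        ≤⟨ +-mono-≤ 2≤p (sum-lower 2≤s) ⟩
  p + sum ν                        ∎
  where open ≤-Reasoning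

private
  excess-shape : ∀ p e l → 2 + p + (l + l + e) ≡ suc l + suc l + (p + e)
  excess-shape = solve-∀

  no-excess : ∀ p e l → 2 + p + (l + l + e) ≡ suc l + suc l → p + e ≡ 0
  no-excess p e l eq = +-cancelˡ-≡ (suc l + suc l) (p + e) 0
    (trans (sym (excess-shape p e l)) (trans eq (sym (+-identityʳ _))))

-- Each part is 2 plus an excess, and the total excess is 0.
sum-tight : ∀ {ν} → All (2 ≤_) ν → sum ν ≡ length ν + length ν → ν ≡ replicate (length ν) 2
sum-tight []                      _  = refl
sum-tight {p ∷ ν} (2≤p ∷ 2≤s) eq
  with p′ , refl ← m≤n⇒∃[o]m+o≡n 2≤p
  with e , eq′ ← m≤n⇒∃[o]m+o≡n (sum-lower 2≤s)
  with refl ← m+n≡0⇒m≡0 p′ (no-excess p′ e (length ν) (trans (cong (2 + p′ +_) eq′) eq)) =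
  cong (2 ∷_) (sum-tight 2≤s (+-cancelˡ-≡ 2 _ _ (trans eq (cong suc (+-suc (length ν) (length ν))))))

-- The total excess over 2 is a single unit, and the order forces it into the first part.
sum-almost-tight : ∀ {ν} → All (2 ≤_) ν → Linked _≥_ ν → sum ν ≡ suc (length ν + length ν) → ∃ λ k → ν ≡ 3 ∷ replicate k 2
sum-almost-tight {p ∷ ν} (2≤p ∷ 2≤s) linked eq
  with p′ , refl ← m≤n⇒∃[o]m+o≡n 2≤p
  with p′
... | suc (suc p″) = contradiction (+-monoʳ-≤ (4 + p″) (sum-lower 2≤s)) (<⇒≱ (≤-trans (≤-reflexive (cong suc eq)) (big p″ (length ν))))
  where
  shape : ∀ p″ l → 4 + p″ + (l + l) ≡ suc (suc (suc l + suc l)) + p″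
  shape = solve-∀
  big : ∀ p″ l → suc (suc (suc l + suc l)) ≤ 4 + p″ + (l + l)
  big p″ l = ≤-trans (m≤m+n _ p″) (≤-reflexive (sym (shape p″ l)))
... | suc zero = length ν , cong (3 ∷_) (sum-tight 2≤s (+-cancelˡ-≡ 3 _ _ (trans eq (cong (suc ∘ suc) (+-suc (length ν) (length ν))))))
... | zero with sum-almost-tight 2≤s (Linked.tail linked) (+-cancelˡ-≡ 2 _ _ (trans eq (cong (suc ∘ suc) (+-suc (length ν) (length ν)))))
... | k , refl with s≤s (s≤s ()) ← Linked.head linked

half-≤ : ∀ {x y} → x + x ≤ suc (y + y) → x ≤ y
half-≤ {x} {y} 2x≤ = ≮⇒≥ λ y<x → 1+n≰n (begin
  suc (suc (y + y))  ≡⟨ cong suc (+-suc y y) ⟨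
  suc y + suc y      ≤⟨ +-mono-≤ y<x y<x ⟩
  x + x              ≤⟨ 2x≤ ⟩
  suc (y + y)        ∎)
  where open ≤-Reasoning

private
  second-hook-shape : ∀ y l → (y + l) + (y + l) ≡ y + (y + (l + l))
  second-hook-shape = solve-∀

-- The second-row hook of `z ∷ y ∷ ν` is `y + length ν`. Its double is covered by `y ≤ z` and by two
-- cells from each row of `ν`, so all hooks but the first are at most half the size.
second-hook-≤ : ∀ {z y ν} → y ≤ z → All (2 ≤_) ν → (y + length ν) + (y + length ν) ≤ z + (y + sum ν)
second-hook-≤ {z} {y} {ν} y≤z 2≤s =
  ≤-trans (≤-reflexive (second-hook-shape y (length ν))) (+-mono-≤ y≤z (+-monoʳ-≤ y (sum-lower 2≤s)))

private
  +-squeeze : ∀ {a b x y} → a ≤ x → b ≤ y → x + y ≡ a + b → x ≡ a × y ≡ b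
  +-squeeze {a} {b} {x} {y} a≤x b≤y eq = x≡a , +-cancelˡ-≡ a y b (trans (cong (_+ y) (sym x≡a)) eq)
    where
    x≡a : x ≡ a
    x≡a = ≤-antisym (+-cancelʳ-≤ b x a (≤-trans (+-monoʳ-≤ x b≤y) (≤-reflexive eq))) a≤x

second-hook-tight : ∀ {z y ν} → y ≤ z → All (2 ≤_) ν → z + (y + sum ν) ≡ (y + length ν) + (y + length ν) →
  z ≡ y × ν ≡ replicate (length ν) 2
second-hook-tight {z} {y} {ν} y≤z 2≤s eq
  with z≡y , eq′ ← +-squeeze y≤z (+-monoʳ-≤ y (sum-lower 2≤s)) (trans eq (second-hook-shape y (length ν))) =
  z≡y , sum-tight 2≤s (+-cancelˡ-≡ y _ _ eq′)

-- Criteria for closedness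

closed-small : ∀ {m G} → All (_≤ m) G → Closed m G
closed-small G≤m a b g∈ = contradiction (All.lookup G≤m g∈) (<⇒≱ (m≤m+n _ _))

-- This is the decomposition 2m = m + m: the hook `suc m` stands for the gap 2m, while m lies in S
-- because 1 is not a hook.
closed⇒suc∉ : ∀ {m G} → All (2 ≤_) G → Closed m G → suc m ∉ G
closed⇒suc∉ {m} {G} 2≤G closed m+1∈ with closed 0 0 (subst (_∈ G) (sym (+-identityʳ (suc m))) m+1∈)
... | inj₁ 1∈ = contradiction (All.lookup 2≤G 1∈) λ { (s≤s ()) }
... | inj₂ 1∈ = contradiction (All.lookup 2≤G 1∈) λ { (s≤s ()) }

-- When only the largest gap exceeds 2m, closedness depends on that gap only through its distance to 2m.
closed-shift : ∀ {m m′ g g′ G} → 0 < m → g′ + m ≡ g + m′ → All (_≤ m′) G → Closed m (g ∷ G) → Closed m′ (g′ ∷ G)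
closed-shift _ _ G≤ _ a b (there ∈G) = contradiction (All.lookup G≤ ∈G) (<⇒≱ (m≤m+n _ _))
closed-shift {m} {m′} {g} {G = G} 0<m g≡ G≤ closed a b (here refl) =
  Sum.map (drop-head (m≤m+n a b)) (drop-head (m≤n+m b a)) (closed a b (here (sym g≡′)))
  where
  shape : ∀ m m′ t → suc m′ + t + m ≡ suc m + t + m′
  shape = solve-∀
  g≡′ : g ≡ suc m + (a + b)
  g≡′ = +-cancelʳ-≡ m′ g _ (trans (sym g≡) (shape m m′ (a + b)))
  -- The head `g` exceeds `suc d`, so the witness lies in `G`, which both lists share.
  drop-head : ∀ {d} → d ≤ a + b → suc d ∈ g ∷ G → suc d ∈ suc m′ + (a + b) ∷ G
  drop-head d≤ (there ∈G) = there ∈G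
  drop-head d≤ (here eq)  = contradiction (≤-trans (+-mono-≤ 0<m d≤) (≤-reflexive (sym (suc-injective (trans eq g≡′))))) 1+n≰n

sum-twos : ∀ k → sum (replicate k 2) ≡ k + k
sum-twos zero    = refl
sum-twos (suc k) = cong suc (trans (cong suc (sum-twos k)) (sym (+-suc k k)))

2∈hooks-twos : ∀ k → 2 ∈ hooks (replicate (suc k) 2)
2∈hooks-twos zero    = here refl
2∈hooks-twos (suc k) = there (2∈hooks-twos k)

∷-twos-nonincr : ∀ {y} k → 2 ≤ y → Linked _≥_ (y ∷ replicate k 2)
∷-twos-nonincr zero    2≤y = [-]
∷-twos-nonincr (suc k) 2≤y = 2≤y ∷ replicate-nonincr (suc k) 2

-- The correspondence

module Correspondence (n : ℕ) where

  -- The j of the theorem, written so that `N ∸ 1` and the numbers `2 + n` and `1 + n` of ones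
  -- compute.
  N : ℕ
  N = 3 + n

  -- The summands on the right stand for PM(3j - 2, j - 1), ā(2j + 1) and 1. The premises keep the
  -- cases disjoint: in `raise` and `keep` the second-row hook differs from `N`, in `move` and
  -- `extra` it equals `N`.
  data Corresponds : List ℕ → List ℕ ⊎ (List ℕ ⊎ ⊤) → Set where
    raise : ∀ {z ν} → Linked _≥_ (z ∷ ν) → N ∉ hooks ν → Corresponds (suc z ∷ ν) (inj₁ (z ∷ ν))
    keep  : ∀ {y ν} → y + length ν ≢ N → Corresponds (y ∷ y ∷ ν) (inj₂ (inj₁ (y ∷ y ∷ ν)))
    move  : ∀ {y ν} → 3 ≤ y → y + suc (length ν) ≡ N → Corresponds (suc y ∷ y ∷ 2 ∷ ν) (inj₂ (inj₁ (y ∷ y ∷ 3 ∷ ν)))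
    extra : Corresponds (3 ∷ 2 ∷ replicate (suc n) 2) (inj₂ (inj₂ tt))

  -- The sizes without ones are 3N - (N - 1) = 2N + 1 here and 3N - 2 - (N - 2) = 2N in `Lower`.
  Upper : List ℕ → Set
  Upper μ = OnelessPartitionOf (suc (N + N)) μ × Closed N (hooks μ)

  Lower : List ℕ ⊎ (List ℕ ⊎ ⊤) → Set
  Lower = Sum.[ (λ μ → OnelessPartitionOf (N + N) μ × Closed (2 + n) (hooks μ)) , Sum.[ IsABar (suc (N + N)) , (λ _ → ⊤) ] ]

  private
    extra-hook : 2 + length (replicate (suc n) 2) ≡ N
    extra-hook = cong (2 +_) (length-replicate (suc n))

    y≱1+y : ∀ {y ν} → ¬ Linked _≥_ (y ∷ suc y ∷ ν)
    y≱1+y (1+y≤y ∷ _) = 1+n≰n 1+y≤y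

    3≰2 : ¬ 3 ≤ 2
    3≰2 (s≤s (s≤s ()))

  injective : ∀ {μ μ′ β} → Corresponds μ β → Corresponds μ′ β → μ ≡ μ′
  injective (raise _ _) (raise _ _) = refl
  injective (keep _)    (keep _)    = refl
  injective (keep ≢N)   (move _ ≡N) = contradiction ≡N ≢N
  injective (move _ ≡N) (keep ≢N)   = contradiction ≡N ≢N
  injective (move _ _)  (move _ _)  = refl
  injective extra       extra       = refl

  functional : ∀ {μ β β′} → Corresponds μ β → Corresponds μ β′ → β ≡ β′
  functional (raise _ _)  (raise _ _)  = refl
  functional (raise l _)  (keep _)     = contradiction l y≱1+y
  functional (raise _ ∉)  (move _ ≡N)  = contradiction (here (sym ≡N)) ∉
  functional (raise _ ∉)  extra        = contradiction (here (sym extra-hook)) ∉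
  functional (keep _)     (raise l _)  = contradiction l y≱1+y
  functional (keep _)     (keep _)     = refl
  functional (move _ ≡N)  (raise _ ∉)  = contradiction (here (sym ≡N)) ∉
  functional (move _ _)   (move _ _)   = refl
  functional (move 3≤2 _) extra        = contradiction 3≤2 3≰2
  functional extra        (raise _ ∉)  = contradiction (here (sym extra-hook)) ∉
  functional extra        (move 3≤2 _) = contradiction 3≤2 3≰2
  functional extra        extra        = refl

  -- The partitions whose gaps include both 2N - 1 and 2N + 1; lowering the largest part
  -- would create the forbidden gap 2 (N - 1) of multiplicity N - 1.
  exceptional : ∀ {y} k → 2 ≤ y → y + suc k ≡ N → Upper (suc y ∷ y ∷ replicate (suc k) 2)
  exceptional {y} k 2≤y eq =
      oneless (m≤n⇒m≤1+n 2≤y ∷ 2≤y ∷ Allₚ.replicate⁺ (suc k) ≤-refl) (n≤1+n y ∷ linked) sum≡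
    , closed
    where
    open ≡-Reasoning
    linked : Linked _≥_ (y ∷ replicate (suc k) 2)
    linked = ∷-twos-nonincr (suc k) 2≤y
    len≡ : y + length (replicate (suc k) 2) ≡ N
    len≡ = trans (cong (y +_) (length-replicate (suc k))) eq
    sum≡ : suc y + (y + sum (replicate (suc k) 2)) ≡ suc (N + N)
    sum≡ = begin
      suc (y + (y + sum (replicate (suc k) 2)))  ≡⟨ cong (λ s → suc (y + (y + s))) (sum-twos (suc k)) ⟩
      suc (y + (y + (suc k + suc k)))            ≡⟨ cong suc (second-hook-shape y (suc k)) ⟨
      suc ((y + suc k) + (y + suc k))            ≡⟨ cong₂ (λ u v → suc (u + v)) eq eq ⟩
      suc (N + N)                                ∎
    closed : Closed N (hooks (suc y ∷ y ∷ replicate (suc k) 2))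
    closed a b (there g∈) =
      contradiction (≤-trans (All.lookup (hooks-upper linked) g∈) (≤-reflexive len≡)) (<⇒≱ (m≤m+n _ _))
    -- The largest hook is `N + 2`, the gap 2N + 1 = N + (N + 1), and N + 1 is a gap because 2 is a
    -- hook.
    closed a b (here eq′) = two a b (+-cancelˡ-≡ (suc N) (a + b) 1
      (trans eq′ (trans (cong suc (+-suc y _)) (trans (cong (suc ∘ suc) len≡) (cong suc (sym (+-comm N 1)))))))
      where
      two∈ : 2 ∈ hooks (suc y ∷ y ∷ replicate (suc k) 2)
      two∈ = there (there (2∈hooks-twos k))
      two : ∀ a b → a + b ≡ 1 → suc a ∈ hooks (suc y ∷ y ∷ replicate (suc k) 2) ⊎ suc b ∈ hooks (suc y ∷ y ∷ replicate (suc k) 2)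
      two 0 1 refl = inj₂ two∈
      two 1 0 refl = inj₁ two∈

  -- The first hook and the multiplicity drop together, so `closed-shift` applies once the lower
  -- hooks are at most N - 1; `raise-head` is the reverse.
  lower-head : ∀ {z ν} → Linked _≥_ (z ∷ ν) → 2 ≤ z → All (_≤ 2 + n) (hooks ν) → Upper (suc z ∷ ν) → Lower (inj₁ (z ∷ ν))
  lower-head {z} {ν} linked 2≤z ≤s (oneless (_ ∷ 2≤s) _ sum≡ , closed) =
    oneless (2≤z ∷ 2≤s) linked (suc-injective sum≡)
    , closed-shift (s≤s z≤n) (+-suc (z + length ν) (2 + n)) ≤s closed

  raise-head : ∀ {z ν} → All (_≤ 2 + n) (hooks ν) → Lower (inj₁ (z ∷ ν)) → Upper (suc z ∷ ν)
  raise-head {z} {ν} ≤s (oneless (2≤z ∷ 2≤s) linked sum≡ , closed) =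
    oneless (m≤n⇒m≤1+n 2≤z ∷ 2≤s) (weaken linked) (cong suc sum≡)
    , closed-shift (s≤s z≤n) (sym (+-suc (z + length ν) (2 + n))) (All.map m≤n⇒m≤1+n ≤s) closed
    where
    weaken : ∀ {ν} → Linked _≥_ (z ∷ ν) → Linked _≥_ (suc z ∷ ν)
    weaken [-]      = [-]
    weaken (r ∷ rs) = m≤n⇒m≤1+n r ∷ rs

  private
    ≤s⇒N∉ : ∀ {G} → All (_≤ 2 + n) G → N ∉ G
    ≤s⇒N∉ ≤s N∈ = 1+n≰n (All.lookup ≤s N∈)

    below-N : ∀ {y ν} → Linked _≥_ (y ∷ ν) → y + length ν ≤ N → y + length ν ≢ N → All (_≤ 2 + n) (hooks (y ∷ ν))
    below-N linked ≤N ≢N = All.map (λ h≤ → ≤-trans h≤ (s≤s⁻¹ (≤∧≢⇒< ≤N ≢N))) (hooks-upper linked)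

  -- With `N` as second-row hook the partner cannot come from `raise`; the value of `y` decides
  -- between `extra` and `move`.
  total-exceptional : ∀ {y ν} k → ν ≡ replicate k 2 → Upper (suc y ∷ y ∷ ν) → y + length ν ≡ N →
    ∃ λ β → Lower β × Corresponds (suc y ∷ y ∷ ν) β
  -- Here y = N, and the largest hook `N + 2` decomposes with `a = 0`, `b = 1`, though neither 1 nor
  -- 2 is a hook.
  total-exceptional {y} zero refl (_ , closed) ≡N = contradiction
      (closed 0 1 (here (trans (+-comm (suc N) 1) (sym (trans (cong suc (+-suc y 0)) (cong (suc ∘ suc) ≡N))))))
      Sum.[ (λ 1∈ → contradiction (All.lookup 3≤hooks 1∈) λ { (s≤s ()) }) , (λ 2∈ → contradiction (All.lookup 3≤hooks 2∈) 3≰2) ]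
    where
    3≤y : 3 ≤ y
    3≤y = ≤-trans (m≤m+n 3 n) (≤-reflexive (trans (sym ≡N) (+-identityʳ y)))
    3≤hooks : All (3 ≤_) (hooks (suc y ∷ y ∷ []))
    3≤hooks = hooks-lower (m≤n⇒m≤1+n 3≤y ∷ 3≤y ∷ [])
  total-exceptional {y} (suc k) refl (oneless (_ ∷ 2≤y ∷ _) _ sum≡ , _) ≡N with y ≟ 2
  ... | yes refl
    with refl ← trans (sym (length-replicate k)) (suc-injective (suc-injective (suc-injective ≡N))) = inj₂ (inj₂ tt) , tt , extra
  -- One cell moves from the first row to the third; `3 ≤ y` keeps the order.
  ... | no  y≢2  = inj₂ (inj₁ (y ∷ y ∷ 3 ∷ replicate k 2)) , IsABar⁺ (oneless
        (2≤y ∷ 2≤y ∷ s≤s (s≤s z≤n) ∷ Allₚ.replicate⁺ k ≤-refl)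
        (≤-refl ∷ 3≤y ∷ ∷-twos-nonincr k (s≤s (s≤s z≤n)))
        (trans (shape y (sum (replicate k 2))) sum≡))
      , move 3≤y ≡N
    where
    3≤y : 3 ≤ y
    3≤y = ≤∧≢⇒< 2≤y (y≢2 ∘ sym)
    shape : ∀ y s → y + (y + (3 + s)) ≡ suc y + (y + (2 + s))
    shape = solve-∀

  total : ∀ μ → Upper μ → ∃ λ β → Lower β × Corresponds μ β
  total [] (oneless _ _ () , _)
  total (w ∷ []) up@(oneless _ _ sum≡ , _)
    with refl ← trans (sym (+-identityʳ w)) sum≡ =
    inj₁ (N + N ∷ []) , lower-head [-] (s≤s (s≤s z≤n)) [] up , raise [-] λ ()
  total (w ∷ y ∷ ν) up@(oneless (2≤w ∷ 2≤y ∷ 2≤s) (y≤w ∷ linked) sum≡ , closed) with w ≟ y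
  -- A second-row hook `N` would make the first hook `N + 1`, the forbidden gap 2N.
  ... | yes refl = inj₂ (inj₁ (y ∷ y ∷ ν)) , IsABar⁺ (proj₁ up) , keep λ ≡N →
    closed⇒suc∉ (hooks-lower (2≤w ∷ 2≤y ∷ 2≤s)) closed (here (sym (trans (+-suc y (length ν)) (cong suc ≡N))))
  total (zero ∷ y ∷ ν) (oneless (() ∷ _) _ _ , _) | no _
  total (suc z ∷ y ∷ ν) up@(oneless (_ ∷ 2≤y ∷ 2≤s) (y≤w ∷ linked) sum≡ , closed) | no w≢y
    -- The second-row hook is at most `N`, and equality is the exceptional case.
    with y≤z ← s≤s⁻¹ (≤∧≢⇒< y≤w (w≢y ∘ sym)) | y + length ν ≟ N
  ... | no ≢N = inj₁ (z ∷ y ∷ ν) , lower-head (y≤z ∷ linked) (≤-trans 2≤y y≤z) ≤s up , raise (y≤z ∷ linked) (≤s⇒N∉ ≤s)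
    where
    ≤s : All (_≤ 2 + n) (hooks (y ∷ ν))
    ≤s = below-N linked (half-≤ (≤-trans (second-hook-≤ y≤z 2≤s) (≤-trans (≤-reflexive (suc-injective sum≡)) (n≤1+n _)))) ≢N
  ... | yes ≡N
    with refl , ν≡ ← second-hook-tight y≤z 2≤s (trans (suc-injective sum≡) (cong₂ _+_ (sym ≡N) (sym ≡N))) =
    total-exceptional (length ν) ν≡ up ≡N

  private
    almost-shape : ∀ y l → suc ((y + l) + (y + l)) ≡ y + (y + suc (l + l))
    almost-shape = solve-∀

  surjective : ∀ β → Lower β → ∃ λ μ → Upper μ × Corresponds μ β
  surjective (inj₁ []) (oneless _ _ () , _)
  surjective (inj₁ (z ∷ [])) low = suc z ∷ [] , raise-head [] low , raise [-] λ ()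
  surjective (inj₁ (z ∷ y ∷ ν)) low@(oneless 2≤s@(_ ∷ _ ∷ 2≤ν) (y≤z ∷ linked) sum≡ , closed) =
    suc z ∷ y ∷ ν , raise-head ≤s low , raise (y≤z ∷ linked) (≤s⇒N∉ ≤s)
    where
    ≤s : All (_≤ 2 + n) (hooks (y ∷ ν))
    ≤s = below-N linked (half-≤ (≤-trans (second-hook-≤ y≤z 2≤ν) (≤-trans (≤-reflexive sum≡) (n≤1+n _))))
      -- For multiplicity N - 1 a second-row hook `N` is the gap 2 (N - 1), which closedness
      -- excludes.
      λ ≡N → closed⇒suc∉ (hooks-lower 2≤s) closed (there (here (sym ≡N)))
  surjective (inj₂ (inj₂ tt)) _ = 3 ∷ 2 ∷ replicate (suc n) 2 , exceptional n ≤-refl refl , extra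
  surjective (inj₂ (inj₁ ps)) abar
    with y , ν , refl , partition@(oneless 2≤s@(2≤y ∷ _ ∷ 2≤ν) linked@(_ ∷ linked′) sum≡) ← IsABar⁻ abar
    with y + length ν ≟ N
  -- All hooks are at most `N`, so closedness is vacuous.
  ... | no ≢N = y ∷ y ∷ ν , (partition , closed-small (All.map (λ h≤ → ≤-trans h≤ first≤N) (hooks-upper linked))) , keep ≢N
    where
    first≤N : y + suc (length ν) ≤ N
    first≤N = ≤-trans (≤-reflexive (+-suc y (length ν)))
      (≤∧≢⇒< (half-≤ (≤-trans (second-hook-≤ {y} ≤-refl 2≤ν) (≤-reflexive sum≡))) ≢N)
  ... | yes ≡N
    -- The second-row hook `N` leaves one cell in `ν` beyond two per row, so `ν` is 3, 2, ..., 2.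
    with k , refl ← sum-almost-tight 2≤ν (Linked.tail linked′) (+-cancelˡ-≡ y _ _ (+-cancelˡ-≡ y _ _
           (trans sum≡ (trans (cong₂ (λ u v → suc (u + v)) (sym ≡N) (sym ≡N)) (almost-shape y (length ν)))))) =
    suc y ∷ y ∷ replicate (suc k) 2
    , exceptional k 2≤y (trans (cong (λ l → y + suc l) (sym (length-replicate k))) ≡N)
    , move (Linked.head linked′) ≡N

  -- Restoring the ones and comparing the counts

  Stripped : List ℕ → List ℕ ⊎ (List ℕ ⊎ ⊤) → Set
  Stripped ps b = ∃₂ λ μ β → ps ≡ μ ++ replicate (2 + n) 1 × b ≡ Sum.map₁ (_++ replicate (1 + n) 1) β × Corresponds μ β

  count : ∀ {p q a} → PMis (3 * N) N p → PMis (3 * N ∸ 2) (N ∸ 1) q → aBarIs (2 * N + 1) a → p ≡ q + (a + 1)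
  count P Q A = Count-unique-of-relation Stripped injective′ functional′ total′ surjective′
    P (Count-⊎ Q (Count-⊎ A Count-⊤))
    where
    size-P : ∀ n → suc ((3 + n) + (3 + n)) + (2 + n) ≡ 3 * (3 + n)
    size-P = solve-∀
    -- The 2 is added on the left to avoid truncated subtraction; `cong (_∸ 2)` later removes it.
    size-Q : ∀ n → 2 + ((3 + n) + (3 + n) + (1 + n)) ≡ 3 * (3 + n)
    size-Q = solve-∀
    size-A : ∀ n → 2 * (3 + n) + 1 ≡ suc ((3 + n) + (3 + n))
    size-A = solve-∀

    Target : List ℕ ⊎ (List ℕ ⊎ ⊤) → Set
    Target = Sum.[ IsPM (3 * N ∸ 2) (N ∸ 1) , Sum.[ IsABar (2 * N + 1) , (λ _ → ⊤) ] ]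

    ++-ones-injective : ∀ c {μ μ′} → μ ++ replicate c 1 ≡ μ′ ++ replicate c 1 → μ ≡ μ′
    ++-ones-injective c = ++-cancelʳ (replicate c 1) _ _

    map₁-injective : ∀ β β′ → Sum.map₁ (_++ replicate (1 + n) 1) β ≡ Sum.map₁ (_++ replicate (1 + n) 1) β′ → β ≡ β′
    map₁-injective (inj₁ _) (inj₁ _) eq   = cong inj₁ (++-ones-injective (1 + n) (inj₁-injective eq))
    map₁-injective (inj₂ _) (inj₂ _) refl = refl

    injective′ : ∀ {x x′ b} → Stripped x b → Stripped x′ b → x ≡ x′
    injective′ (_ , β , refl , refl , r) (_ , β′ , refl , eq , r′)
      with refl ← map₁-injective β β′ eq = cong (_++ replicate (2 + n) 1) (injective r r′)

    functional′ : ∀ {x b b′} → Stripped x b → Stripped x b′ → b ≡ b′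
    functional′ (μ , _ , refl , refl , r) (μ′ , _ , eq , refl , r′)
      with refl ← ++-ones-injective (2 + n) {μ} {μ′} eq = cong (Sum.map₁ _) (functional r r′)

    lower⇒target : ∀ β → Lower β → Target (Sum.map₁ (_++ replicate (1 + n) 1) β)
    lower⇒target (inj₁ _)         (partition , closed) = IsPM⁺ (cong (_∸ 2) (size-Q n)) partition closed
    lower⇒target (inj₂ (inj₁ ps)) abar                = subst (λ s → IsABar s ps) (sym (size-A n)) abar
    lower⇒target (inj₂ (inj₂ _))  _                   = tt

    target⇒lower : ∀ b → Target b → ∃ λ β → b ≡ Sum.map₁ (_++ replicate (1 + n) 1) β × Lower β
    target⇒lower (inj₁ _) pm
      with μ , refl , low ← IsPM⁻ (N + N) (cong (_∸ 2) (size-Q n)) pm = inj₁ μ , refl , low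
    target⇒lower (inj₂ (inj₁ ps)) abar = inj₂ (inj₁ ps) , refl , subst (λ s → IsABar s ps) (size-A n) abar
    target⇒lower (inj₂ (inj₂ tt)) _    = inj₂ (inj₂ tt) , refl , tt

    total′ : ∀ x → IsPM (3 * N) N x → ∃ λ b → Target b × Stripped x b
    total′ x pm
      with μ , x≡ , up ← IsPM⁻ (suc (N + N)) (size-P n) pm
      with β , low , r ← total μ up = _ , lower⇒target β low , μ , β , x≡ , refl , r

    surjective′ : ∀ b → Target b → ∃ λ x → IsPM (3 * N) N x × Stripped x b
    surjective′ b t
      with β , b≡ , low ← target⇒lower b t
      with μ , (partition , closed) , r ← surjective β low = _ , IsPM⁺ (size-P n) partition closed , μ , β , refl , b≡ , r

theorem5p8 : (j : ℕ) → 4 ≤ j → (p q a : ℕ) →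
    PMis (3 * j) j p → PMis (3 * j ∸ 2) (j ∸ 1) q → aBarIs (2 * j + 1) a →
    p ≡ q + (a + 1)
theorem5p8 (suc (suc (suc n))) (s≤s (s≤s (s≤s _))) p q a = Correspondence.count n
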